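{- Let $\mathbf A=\langle A,\land^A,\lor^A,\supset^A,\neg^A,\top^A\rangle$ be a residuated De Morgan lattice and let $\mathbf A^-=\langle A^-,\land^A,\lor^A\rangle$ be the sublattice of $\mathbf A$ with universe $A^-=\{a\in A: a\leq\top^A\}$. Then: (i) $\mathbf A^-$ is dually isomorphic to $\mathbf A^+=\langle A^+,\land^A,\lor^A\rangle$, the sublattice of $\mathbf A$ with universe $A^+=\{a\in A: a\geq\top^A\}$. (ii) $\mathbf A^-$ and $\mathbf A^+$ are relatively complemented. (iii) There is an embedding $h:A\to A^-\times A^-$ of $\mathbf A$ into the implicative bilattice $\mathbf B=\langle\mathbf A^-\odot\mathbf A^-,\supset^B\rangle$ (or into $\langle\mathbf A^+\odot\mathbf A^+,\supset\rangle$). (iv) If $f:A\to B_1$ is a homomorphism from $\mathbf A$ to an implicative bilattice $\mathbf B_1$, then there is a unique map $f':A^-\times A^-\to B_1$ which is also a homomorphism of $\mathbf B=\langle\mathbf A^-\odot\mathbf A^-,\supset^B\rangle$ into $\mathbf B_1$ such that $f'\cdot h=f$. Moreover, if $f$ is injective, so is $f'$.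
   Context: A residuated De Morgan lattice is an algebra $\langle A,\land,\lor,\supset,\neg,\top\rangle$ such that $\langle A,\land,\lor,\neg\rangle$ is a De Morgan lattice (distributive lattice, not necessarily bounded, with an involutive order-reversing $\neg$) and: (RD0) $\top\approx\neg\top$; (RD1) $\top\supset x\approx x$; (RD2) $x\supset(y\supset z)\approx(x\land y)\supset z$; (RD3) $\top\land(((x\supset y)\supset x)\supset x)\approx\top$; (RD4) $(x\lor y)\supset z\approx(x\supset z)\land(y\supset z)$; (RD5) $x\land(((x\supset y)\land(\neg y\supset\neg x))\supset y)\approx x$; (RD6) $\neg(x\supset y)\supset z\approx(x\land\neg y)\supset z$. A bilattice is an algebra $\langle B,\land,\lor,\otimes,\oplus,\neg\rangle$ such that $\langle B,\land,\lor\rangle$ and $\langle B,\otimes,\oplus\rangle$ are lattices (not necessarily bounded) with orders $\leq_t$ and $\leq_k$, and $\neg$ is unary with: $a\leq_t b\Rightarrow\neg b\leq_t\neg a$; $a\leq_k b\Rightarrow\neg a\leq_k\neg b$; $\neg\neg a=a$. An implicative bilattice is an algebra $\langle B,\land,\lor,\otimes,\oplus,\supset,\neg\rangle$ whose $\supset$-free reduct is a bilattice and which satisfies: (IB1) $(x\supset x)\supset y\approx y$; (IB2) $x\supset(y\supset z)\approx(x\land y)\supset z\approx(x\otimes y)\supset z$; (IB3) $((x\supset y)\supset x)\supset x\approx x\supset x$; (IB4) $(x\lor y)\supset z\approx(x\supset z)\land(y\supset z)\approx(x\oplus y)\supset z$; (IB5) $x\land((x\supset y)\supset(x\otimes y))\approx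 x$; (IB6) $\neg(x\supset y)\supset z\approx(x\land\neg y)\supset z$. In an implicative bilattice the term $(x\supset x)\oplus\neg(x\supset x)$ is constant and its value $\top$ is the $\leq_k$-maximum. For a relatively complemented distributive lattice $\mathbf L=\langle L,\sqcap,\sqcup\rangle$ with maximum $1$, let $a\backslash b$ be the relative complement of $a$ in $[a\sqcap b,1]$. $\langle\mathbf L\odot\mathbf L,\supset\rangle$ is the implicative bilattice with universe $L\times L$ and operations $\langle a_1,a_2\rangle\land\langle b_1,b_2\rangle=\langle a_1\sqcap b_1,a_2\sqcup b_2\rangle$, $\langle a_1,a_2\rangle\lor\langle b_1,b_2\rangle=\langle a_1\sqcup b_1,a_2\sqcap b_2\rangle$, $\langle a_1,a_2\rangle\otimes\langle b_1,b_2\rangle=\langle a_1\sqcap b_1,a_2\sqcap b_2\rangle$, $\langle a_1,a_2\rangle\oplus\langle b_1,b_2\rangle=\langle a_1\sqcup b_1,a_2\sqcup b_2\rangle$, $\neg\langle a_1,a_2\rangle=\langle a_2,a_1\rangle$, $\langle a_1,a_2\rangle\supset\langle b_1,b_2\rangle=\langle a_1\backslash b_1,a_1\sqcap b_2\rangle$. For $\mathbf L=\mathbf A^-$ (with maximum $\top^A$) this gives $\mathbf B$; $\langle\mathbf A^+\odot\mathbf A^+,\supset\rangle$ denotes the structure formed in the same way from $\mathbf A^+$. A homomorphism (resp. embedding) from a residuated De Morgan lattice into an implicative bilattice is a map (resp. injective map) preserving $\land,\lor,\supset,\neg,\top$; a homomorphism between implicative bilattices preserves all operations. The embedding $h$ meant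 in (iii) and (iv) is $h(a)=\langle a\land^A\top^A,\ \neg^A a\land^A\top^A\rangle$.
   Formalization: In (iii), the structure ⟨A⁺⊙A⁺,⊃⟩ is formed from the order dual of A⁺, since A⁺ has minimum ⊤ but possibly no maximum, so the relative complement a\b in [a⊓b,1] would otherwise be undefined. -}

module Defs where

open import Algebra.Core using (Op₁; Op₂)
open import Algebra.Lattice.Bundles using (Lattice; DistributiveLattice; RawLattice)
open import Algebra.Lattice.Morphism.Structures
  using (IsLatticeHomomorphism; IsLatticeMonomorphism; IsLatticeIsomorphism)
open import Algebra.Lattice.Structures using (IsLattice; IsDistributiveLattice)
import Algebra.Definitions as AlgebraDefinitions
import Algebra.Lattice.Morphism.LatticeMonomorphism as LatticeMonomorphism
import Algebra.Lattice.Properties.DistributiveLattice as DistributiveLatticeProperties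
import Algebra.Morphism.Definitions as MorphismDefinitions
open import Data.Product using (Σ; ∃; _×_; _,_; proj₁; proj₂; map; swap)
open import Data.Product.Relation.Binary.Pointwise.NonDependent
  using (Pointwise; ×-isEquivalence)
open import Function.Base using (id)
open import Function.Definitions using (Injective)
open import Level using (Level; suc; _⊔_)
open import Relation.Binary.Core using (Rel)
import Relation.Binary.Construct.NaturalOrder.Left as NaturalOrder
open import Relation.Binary.Definitions using (Maximum; Antitonic₁; Monotonic₁)
import Relation.Binary.Lattice as Order
import Relation.Binary.Reasoning.PartialOrder as ≤-Reasoning

private
  variable
    a c c₁ c₂ ℓ ℓ₁ ℓ₂ p : Level

module _ {A : Set a} (_≈_ : Rel A ℓ) where

  open AlgebraDefinitions _≈_

  record IsDeMorganLattice (_∨_ _∧_ : Op₂ A) (¬_ : Op₁ A) : Set (a ⊔ ℓ) where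
    open NaturalOrder _≈_ _∧_ using (_≤_)
    field
      isDistributiveLattice : IsDistributiveLattice _≈_ _∨_ _∧_
      ¬-cong                : Congruent₁ ¬_
      ¬-antitone            : Antitonic₁ _≤_ _≤_ ¬_
      ¬-involutive          : Involutive ¬_

record ResiduatedDeMorganLattice c ℓ : Set (suc (c ⊔ ℓ)) where
  infix  8 ¬_
  infixr 7 _∧_
  infixr 6 _∨_
  infixr 5 _⊃_
  infix  4 _≈_
  field
    Carrier           : Set c
    _≈_               : Rel Carrier ℓ
    _∧_               : Op₂ Carrier
    _∨_               : Op₂ Carrier
    _⊃_               : Op₂ Carrier
    ¬_                : Op₁ Carrier
    ⊤                 : Carrier
    isDeMorganLattice : IsDeMorganLattice _≈_ _∨_ _∧_ ¬_

  open AlgebraDefinitions _≈_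

  field
    ⊃-cong : Congruent₂ _⊃_
    RD0    : ⊤ ≈ ¬ ⊤
    RD1    : ∀ x → (⊤ ⊃ x) ≈ x
    RD2    : ∀ x y z → (x ⊃ (y ⊃ z)) ≈ ((x ∧ y) ⊃ z)
    RD3    : ∀ x y → (⊤ ∧ (((x ⊃ y) ⊃ x) ⊃ x)) ≈ ⊤
    RD4    : ∀ x y z → ((x ∨ y) ⊃ z) ≈ ((x ⊃ z) ∧ (y ⊃ z))
    RD5    : ∀ x y → (x ∧ (((x ⊃ y) ∧ (¬ y ⊃ ¬ x)) ⊃ y)) ≈ x
    RD6    : ∀ x y z → (¬ (x ⊃ y) ⊃ z) ≈ ((x ∧ ¬ y) ⊃ z)

  open IsDeMorganLattice isDeMorganLattice public

  distributiveLattice : DistributiveLattice c ℓ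
  distributiveLattice = record { isDistributiveLattice = isDistributiveLattice }

  open DistributiveLattice distributiveLattice public using (lattice; rawLattice)

  open NaturalOrder _≈_ _∧_ public using (_≤_)

module _ {A : Set a} (_≈_ : Rel A ℓ) where

  open AlgebraDefinitions _≈_

  record IsBilattice (_∨_ _∧_ _⊕_ _⊗_ : Op₂ A) (¬_ : Op₁ A) : Set (a ⊔ ℓ) where
    open NaturalOrder _≈_ _∧_ public using () renaming (_≤_ to _≤ₜ_)
    open NaturalOrder _≈_ _⊗_ public using () renaming (_≤_ to _≤ₖ_)
    field
      isLatticeₜ   : IsLattice _≈_ _∨_ _∧_
      isLatticeₖ   : IsLattice _≈_ _⊕_ _⊗_
      ¬-cong       : Congruent₁ ¬_
      ¬-antitoneₜ  : Antitonic₁ _≤ₜ_ _≤ₜ_ ¬_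
      ¬-monotoneₖ  : Monotonic₁ _≤ₖ_ _≤ₖ_ ¬_
      ¬-involutive : Involutive ¬_

record ImplicativeBilattice c ℓ : Set (suc (c ⊔ ℓ)) where
  infix  8 ¬_
  infixr 7 _∧_ _⊗_
  infixr 6 _∨_ _⊕_
  infixr 5 _⊃_
  infix  4 _≈_
  field
    Carrier     : Set c
    _≈_         : Rel Carrier ℓ
    _∧_         : Op₂ Carrier
    _∨_         : Op₂ Carrier
    _⊗_         : Op₂ Carrier
    _⊕_         : Op₂ Carrier
    _⊃_         : Op₂ Carrier
    ¬_          : Op₁ Carrier
    isBilattice : IsBilattice _≈_ _∨_ _∧_ _⊕_ _⊗_ ¬_

  open AlgebraDefinitions _≈_

  field
    ⊃-cong : Congruent₂ _⊃_
    IB1    : ∀ x y → ((x ⊃ x) ⊃ y) ≈ y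
    IB2-∧  : ∀ x y z → (x ⊃ (y ⊃ z)) ≈ ((x ∧ y) ⊃ z)
    IB2-⊗  : ∀ x y z → ((x ∧ y) ⊃ z) ≈ ((x ⊗ y) ⊃ z)
    IB3    : ∀ x y → (((x ⊃ y) ⊃ x) ⊃ x) ≈ (x ⊃ x)
    IB4-∨  : ∀ x y z → ((x ∨ y) ⊃ z) ≈ ((x ⊃ z) ∧ (y ⊃ z))
    IB4-⊕  : ∀ x y z → ((x ⊃ z) ∧ (y ⊃ z)) ≈ ((x ⊕ y) ⊃ z)
    IB5    : ∀ x y → (x ∧ ((x ⊃ y) ⊃ (x ⊗ y))) ≈ x
    IB6    : ∀ x y z → (¬ (x ⊃ y) ⊃ z) ≈ ((x ∧ ¬ y) ⊃ z)

  open IsBilattice isBilattice public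

  latticeₜ : Lattice c ℓ
  latticeₜ = record { isLattice = isLatticeₜ }

  latticeₖ : Lattice c ℓ
  latticeₖ = record { isLattice = isLatticeₖ }

  rawLatticeₜ : RawLattice c ℓ
  rawLatticeₜ = Lattice.rawLattice latticeₜ

  rawLatticeₖ : RawLattice c ℓ
  rawLatticeₖ = Lattice.rawLattice latticeₖ

  -- The value does not depend on x.  The argument is kept because the
  -- signature has no constants, so the carrier may be empty.
  ⊤[_] : Op₁ Carrier
  ⊤[ x ] = (x ⊃ x) ⊕ ¬ (x ⊃ x)

module _ (𝐀 : ResiduatedDeMorganLattice c₁ ℓ₁) (𝐁 : ImplicativeBilattice c₂ ℓ₂) where

  private
    module A = ResiduatedDeMorganLattice 𝐀
    module B = ImplicativeBilattice 𝐁

  open MorphismDefinitions A.Carrier B.Carrier B._≈_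

  record IsResiduatedHomomorphism (f : A.Carrier → B.Carrier)
         : Set (c₁ ⊔ c₂ ⊔ ℓ₁ ⊔ ℓ₂) where
    field
      isLatticeHomomorphism : IsLatticeHomomorphism A.rawLattice B.rawLatticeₜ f
      ⊃-homo                : Homomorphic₂ f A._⊃_ B._⊃_
      ¬-homo                : Homomorphic₁ f A.¬_ B.¬_
      ⊤-homo                : ∀ x → Homomorphic₀ f A.⊤ B.⊤[ x ]

  record IsResiduatedEmbedding (f : A.Carrier → B.Carrier)
         : Set (c₁ ⊔ c₂ ⊔ ℓ₁ ⊔ ℓ₂) where
    field
      isResiduatedHomomorphism : IsResiduatedHomomorphism f
      injective                : Injective A._≈_ B._≈_ f

module _ (𝐁₁ : ImplicativeBilattice c₁ ℓ₁) (𝐁₂ : ImplicativeBilattice c₂ ℓ₂) where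

  private
    module B₁ = ImplicativeBilattice 𝐁₁
    module B₂ = ImplicativeBilattice 𝐁₂

  open MorphismDefinitions B₁.Carrier B₂.Carrier B₂._≈_

  record IsBilatticeHomomorphism (f : B₁.Carrier → B₂.Carrier)
         : Set (c₁ ⊔ c₂ ⊔ ℓ₁ ⊔ ℓ₂) where
    field
      isLatticeHomomorphismₜ : IsLatticeHomomorphism B₁.rawLatticeₜ B₂.rawLatticeₜ f
      isLatticeHomomorphismₖ : IsLatticeHomomorphism B₁.rawLatticeₖ B₂.rawLatticeₖ f
      ⊃-homo                 : Homomorphic₂ f B₁._⊃_ B₂._⊃_
      ¬-homo                 : Homomorphic₁ f B₁.¬_ B₂.¬_

dual : DistributiveLattice c ℓ → DistributiveLattice c ℓ
dual = DistributiveLatticeProperties.∧-∨-distributiveLattice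

DuallyIsomorphic : DistributiveLattice c₁ ℓ₁ → DistributiveLattice c₂ ℓ₂ →
                   Set (c₁ ⊔ c₂ ⊔ ℓ₁ ⊔ ℓ₂)
DuallyIsomorphic L M = ∃ (IsLatticeIsomorphism (rawLattice L) (rawLattice (dual M)))
  where open DistributiveLattice using (rawLattice)

module _ (L : DistributiveLattice c ℓ) where

  open DistributiveLattice L
  open NaturalOrder _≈_ _∧_ using (_≤_)

  sublattice : (P : Carrier → Set p) →
               (∀ {x y} → P x → P y → P (x ∨ y)) →
               (∀ {x y} → P x → P y → P (x ∧ y)) →
               DistributiveLattice (c ⊔ p) ℓ
  sublattice {p = p} P P-∨ P-∧ = record
    { isDistributiveLattice =
        LatticeMonomorphism.isDistributiveLattice inclusion isDistributiveLattice
    }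
    where
    raw : RawLattice (c ⊔ p) ℓ
    raw = record
      { Carrier = Σ Carrier P
      ; _≈_     = λ x y → proj₁ x ≈ proj₁ y
      ; _∧_     = λ (x , px) (y , py) → x ∧ y , P-∧ px py
      ; _∨_     = λ (x , px) (y , py) → x ∨ y , P-∨ px py
      }

    inclusion : IsLatticeMonomorphism raw rawLattice proj₁
    inclusion = record
      { isLatticeHomomorphism = record
        { isRelHomomorphism = record { cong = id }
        ; ∧-homo            = λ _ _ → refl
        ; ∨-homo            = λ _ _ → refl
        }
      ; injective = id
      }

  -- y is a complement of x in the interval [u , v]; that y itself lies
  -- in the interval follows from the two equations.
  IsRelativeComplement : (u v x y : Carrier) → Set ℓ
  IsRelativeComplement u v x y = (x ∧ y ≈ u) × (x ∨ y ≈ v)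

  RelativelyComplemented : Set (c ⊔ ℓ)
  RelativelyComplemented =
    ∀ u v x → u ≤ x → x ≤ v → ∃ (IsRelativeComplement u v x)

dual-relativelyComplemented : (L : DistributiveLattice c ℓ) →
  RelativelyComplemented L → RelativelyComplemented (dual L)
dual-relativelyComplemented L rc u v x u≤x x≤v =
  map id swap (rc v u x (flip x≤v) (flip u≤x))
  where
  open DistributiveLattice L
  flip : ∀ {x y} → x ≈ x ∨ y → y ≈ y ∧ x
  flip {x} {y} x≈x∨y =
    sym (trans (∧-congˡ (trans x≈x∨y (∨-comm x y))) (∧-absorbs-∨ y x))

module _ (L : DistributiveLattice c ℓ) where

  open DistributiveLattice L renaming (_∧_ to _⊓_; _∨_ to _⊔ᴸ_)
  open NaturalOrder _≈_ _⊓_ using (_≤_)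

  module Square
    (relativelyComplemented : RelativelyComplemented L)
    (1# : Carrier) (maximum : Maximum _≤_ 1#)
    where

    private
      module P = DistributiveLatticeProperties L
      open Order.Lattice P.∨-∧-orderTheoreticLattice
        using (x∧y≤x; x∧y≤y; x≤x∨y; y≤x∨y; ∨-least; ∧-greatest; antisym)
        renaming (trans to ≤-trans; refl to ≤-refl; reflexive to ≤-reflexive)
      open ≤-Reasoning P.poset

    complement : ∀ x y → ∃ (IsRelativeComplement L (x ⊓ y) 1# x)
    complement x y =
      relativelyComplemented (x ⊓ y) 1# x (x∧y≤x x y) (maximum x)

    infixr 5 _∖_
    _∖_ : Op₂ Carrier
    x ∖ y = proj₁ (complement x y)

    modus-ponens : ∀ {x y z} → z ≤ x ∖ y → x ⊓ z ≤ y
    modus-ponens {x} {y} {z} z≤x∖y = begin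
      x ⊓ z       ≤⟨ ∧-greatest (x∧y≤x x z) (≤-trans (x∧y≤y x z) z≤x∖y) ⟩
      x ⊓ (x ∖ y) ≈⟨ proj₁ (proj₂ (complement x y)) ⟩
      x ⊓ y       ≤⟨ x∧y≤y x y ⟩
      y           ∎

    residual : ∀ {x y z} → x ⊓ z ≤ y → z ≤ x ∖ y
    residual {x} {y} {z} x⊓z≤y = begin
      z                          ≤⟨ ∧-greatest ≤-refl (maximum z) ⟩
      z ⊓ 1#                     ≈⟨ ∧-congˡ (proj₂ (proj₂ (complement x y))) ⟨
      z ⊓ (x ⊔ᴸ (x ∖ y))         ≈⟨ ∧-distribˡ-∨ z x (x ∖ y) ⟩
      (z ⊓ x) ⊔ᴸ (z ⊓ (x ∖ y))   ≤⟨ ∨-least lemma (x∧y≤y z _) ⟩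
      x ∖ y                      ∎
      where
      lemma : z ⊓ x ≤ x ∖ y
      lemma = begin
        z ⊓ x       ≈⟨ ∧-comm z x ⟩
        x ⊓ z       ≤⟨ ∧-greatest (x∧y≤x x z) x⊓z≤y ⟩
        x ⊓ y       ≈⟨ proj₁ (proj₂ (complement x y)) ⟨
        x ⊓ (x ∖ y) ≤⟨ x∧y≤y x _ ⟩
        x ∖ y       ∎

    ∖-mono : ∀ {x x′ y y′} → x′ ≤ x → y ≤ y′ → x ∖ y ≤ x′ ∖ y′
    ∖-mono {x} {x′} x′≤x y≤y′ = residual (≤-trans
      (∧-greatest (≤-trans (x∧y≤x _ _) x′≤x) (x∧y≤y _ _))
      (≤-trans (modus-ponens ≤-refl) y≤y′))

    ∖-cong : ∀ {x x′ y y′} → x ≈ x′ → y ≈ y′ → x ∖ y ≈ x′ ∖ y′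
    ∖-cong x≈x′ y≈y′ = antisym
      (∖-mono (≤-reflexive (sym x≈x′)) (≤-reflexive y≈y′))
      (∖-mono (≤-reflexive x≈x′) (≤-reflexive (sym y≈y′)))

    ∖-self : ∀ x → x ∖ x ≈ 1#
    ∖-self x = antisym (maximum _) (residual (x∧y≤x x 1#))

    1∖ : ∀ x → (1# ∖ x) ≈ x
    1∖ x = antisym
      (≤-trans (∧-greatest (maximum _) ≤-refl) (modus-ponens ≤-refl))
      (residual (x∧y≤y 1# x))

    ∖-curry : ∀ x y z → (x ∖ (y ∖ z)) ≈ ((x ⊓ y) ∖ z)
    ∖-curry x y z = antisym
      (residual (≤-trans
        (≤-reflexive (trans (∧-congʳ (∧-comm x y)) (∧-assoc y x _)))
        (modus-ponens (modus-ponens ≤-refl))))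
      (residual (residual (≤-trans
        (≤-reflexive (trans (sym (∧-assoc y x _)) (∧-congʳ (∧-comm y x))))
        (modus-ponens ≤-refl))))

    ∖-peirce : ∀ x y → ((x ∖ y) ∖ x) ≈ x
    ∖-peirce x y = antisym z≤x (residual (x∧y≤y _ x))
      where
      z = (x ∖ y) ∖ x
      z≤x : z ≤ x
      z≤x = begin
        z                         ≤⟨ ∧-greatest ≤-refl (maximum z) ⟩
        z ⊓ 1#                    ≈⟨ ∧-congˡ (proj₂ (proj₂ (complement x y))) ⟨
        z ⊓ (x ⊔ᴸ (x ∖ y))        ≈⟨ ∧-distribˡ-∨ z x (x ∖ y) ⟩
        (z ⊓ x) ⊔ᴸ (z ⊓ (x ∖ y))  ≤⟨ ∨-least (x∧y≤y z x)
                                       (≤-trans (≤-reflexive (∧-comm z _))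
                                                (modus-ponens ≤-refl)) ⟩
        x                         ∎

    ∖-∨ : ∀ x y z → ((x ⊔ᴸ y) ∖ z) ≈ ((x ∖ z) ⊓ (y ∖ z))
    ∖-∨ x y z = antisym
      (∧-greatest (∖-mono (x≤x∨y x y) ≤-refl) (∖-mono (y≤x∨y x y) ≤-refl))
      (residual (≤-trans (≤-reflexive (∧-distribʳ-∨ _ x y))
        (∨-least (modus-ponens (x∧y≤x _ _)) (modus-ponens (x∧y≤y _ _)))))

    Car : Set c
    Car = Carrier × Carrier

    _≋_ : Rel Car ℓ
    _≋_ = Pointwise _≈_ _≈_

    infixr 7 _∧_ _⊗_
    infixr 6 _∨_ _⊕_
    infixr 5 _⊃_
    infix  8 ¬_

    _∧_ _∨_ _⊗_ _⊕_ _⊃_ : Op₂ Car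
    (x₁ , x₂) ∧ (y₁ , y₂) = x₁ ⊓ y₁ , x₂ ⊔ᴸ y₂
    (x₁ , x₂) ∨ (y₁ , y₂) = x₁ ⊔ᴸ y₁ , x₂ ⊓ y₂
    (x₁ , x₂) ⊗ (y₁ , y₂) = x₁ ⊓ y₁ , x₂ ⊓ y₂
    (x₁ , x₂) ⊕ (y₁ , y₂) = x₁ ⊔ᴸ y₁ , x₂ ⊔ᴸ y₂
    (x₁ , x₂) ⊃ (y₁ , y₂) = (x₁ ∖ y₁) , x₁ ⊓ y₂

    ¬_ : Op₁ Car
    ¬_ = swap

    ∧-∨-isLattice : IsLattice _≋_ _∨_ _∧_
    ∧-∨-isLattice = record
      { isEquivalence = ×-isEquivalence isEquivalence isEquivalence
      ; ∨-comm        = λ x y → ∨-comm _ _ , ∧-comm _ _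
      ; ∨-assoc       = λ x y z → ∨-assoc _ _ _ , ∧-assoc _ _ _
      ; ∨-cong        = λ (p , q) (r , s) → ∨-cong p r , ∧-cong q s
      ; ∧-comm        = λ x y → ∧-comm _ _ , ∨-comm _ _
      ; ∧-assoc       = λ x y z → ∧-assoc _ _ _ , ∨-assoc _ _ _
      ; ∧-cong        = λ (p , q) (r , s) → ∧-cong p r , ∨-cong q s
      ; absorptive    = (λ x y → ∨-absorbs-∧ _ _ , ∧-absorbs-∨ _ _)
                      , (λ x y → ∧-absorbs-∨ _ _ , ∨-absorbs-∧ _ _)
      }

    ⊗-⊕-isLattice : IsLattice _≋_ _⊕_ _⊗_
    ⊗-⊕-isLattice = record
      { isEquivalence = ×-isEquivalence isEquivalence isEquivalence
      ; ∨-comm        = λ x y → ∨-comm _ _ , ∨-comm _ _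
      ; ∨-assoc       = λ x y z → ∨-assoc _ _ _ , ∨-assoc _ _ _
      ; ∨-cong        = λ (p , q) (r , s) → ∨-cong p r , ∨-cong q s
      ; ∧-comm        = λ x y → ∧-comm _ _ , ∧-comm _ _
      ; ∧-assoc       = λ x y z → ∧-assoc _ _ _ , ∧-assoc _ _ _
      ; ∧-cong        = λ (p , q) (r , s) → ∧-cong p r , ∧-cong q s
      ; absorptive    = (λ x y → ∨-absorbs-∧ _ _ , ∨-absorbs-∧ _ _)
                      , (λ x y → ∧-absorbs-∨ _ _ , ∧-absorbs-∨ _ _)
      }

    ∧⇒∨ : ∀ {x y} → y ≈ y ⊓ x → x ≈ x ⊔ᴸ y
    ∧⇒∨ {x} {y} y≤x = sym (trans (∨-congˡ (trans y≤x (∧-comm y x))) (∨-absorbs-∧ x y))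

    ∨⇒∧ : ∀ {x y} → y ≈ y ⊔ᴸ x → x ≈ x ⊓ y
    ∨⇒∧ {x} {y} y≈y∨x = sym (trans (∧-congˡ (trans y≈y∨x (∨-comm y x))) (∧-absorbs-∨ x y))

    implicativeBilattice : ImplicativeBilattice c ℓ
    implicativeBilattice = record
      { Carrier     = Car
      ; _≈_         = _≋_
      ; _∧_         = _∧_
      ; _∨_         = _∨_
      ; _⊗_         = _⊗_
      ; _⊕_         = _⊕_
      ; _⊃_         = _⊃_
      ; ¬_          = ¬_
      ; isBilattice = record
        { isLatticeₜ   = ∧-∨-isLattice
        ; isLatticeₖ   = ⊗-⊕-isLattice
        ; ¬-cong       = swap
        ; ¬-antitoneₜ  = λ (p , q) → ∨⇒∧ q , ∧⇒∨ p
        ; ¬-monotoneₖ  = swap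
        ; ¬-involutive = λ _ → refl , refl
        }
      ; ⊃-cong = λ (p , _) (r , s) → ∖-cong p r , ∧-cong p s
      ; IB1    = λ (x₁ , _) (y₁ , y₂) →
                   trans (∖-cong (∖-self x₁) refl) (1∖ y₁)
                 , antisym (x∧y≤y _ y₂)
                     (∧-greatest
                       (≤-trans (maximum y₂) (≤-reflexive (sym (∖-self x₁))))
                       ≤-refl)
      ; IB2-∧  = λ (x₁ , _) (y₁ , _) (z₁ , z₂) →
                   ∖-curry x₁ y₁ z₁ , sym (∧-assoc x₁ y₁ z₂)
      ; IB2-⊗  = λ _ _ _ → refl , refl
      ; IB3    = λ (x₁ , x₂) (y₁ , _) →
                   ∖-cong (∖-peirce x₁ y₁) refl , ∧-congʳ (∖-peirce x₁ y₁)
      ; IB4-∨  = λ (x₁ , _) (y₁ , _) (z₁ , z₂) →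
                   ∖-∨ x₁ y₁ z₁ , ∧-distribʳ-∨ z₂ x₁ y₁
      ; IB4-⊕  = λ (x₁ , _) (y₁ , _) (z₁ , z₂) →
                   sym (∖-∨ x₁ y₁ z₁) , sym (∧-distribʳ-∨ z₂ x₁ y₁)
      ; IB5    = λ (x₁ , x₂) (y₁ , y₂) →
                   sym (residual (∧-greatest (x∧y≤y _ x₁)
                     (≤-trans (≤-reflexive (∧-comm _ x₁)) (modus-ponens ≤-refl))))
                 , antisym
                     (∨-least ≤-refl (≤-trans (x∧y≤y _ _) (x∧y≤x x₂ y₂)))
                     (x≤x∨y x₂ _)
      ; IB6    = λ _ _ _ → refl , refl
      }

module _ (𝐀 : ResiduatedDeMorganLattice c ℓ) where

  open ResiduatedDeMorganLattice 𝐀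
  open Order.Lattice
    (DistributiveLatticeProperties.∨-∧-orderTheoreticLattice distributiveLattice)
    using (x∧y≤x; x∧y≤y; x≤x∨y; ∨-least; ∧-greatest)
    renaming (trans to ≤-trans; refl to ≤-refl)
  open DistributiveLattice distributiveLattice using (sym; trans; ∧-comm; ∨-congˡ; ∨-absorbs-∧)

  infix 9 _⁻ _⁺

  _⁻ : DistributiveLattice (c ⊔ ℓ) ℓ
  _⁻ = sublattice distributiveLattice (_≤ ⊤)
    ∨-least
    (λ {x} {y} x≤⊤ _ → ≤-trans (x∧y≤x x y) x≤⊤)

  _⁺ : DistributiveLattice (c ⊔ ℓ) ℓ
  _⁺ = sublattice distributiveLattice (⊤ ≤_)
    (λ {x} {y} ⊤≤x _ → ≤-trans ⊤≤x (x≤x∨y x y))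
    ∧-greatest

  square⁻ : RelativelyComplemented _⁻ → ImplicativeBilattice (c ⊔ ℓ) ℓ
  square⁻ rc = Square.implicativeBilattice _⁻ rc (⊤ , ≤-refl) proj₂

  -- In 𝐀⁺ the element ⊤ is the minimum and a maximum need not exist, so
  -- the construction, which needs a maximum, is applied to the order dual
  -- of 𝐀⁺.  (In an implicative bilattice ⊤ is the ≤ₖ-maximum, so ⟨⊤ , ⊤⟩
  -- can only be the image of ⊤ if ⊤ is the maximum of the factors.)
  square⁺ : RelativelyComplemented _⁺ → ImplicativeBilattice (c ⊔ ℓ) ℓ
  square⁺ rc = Square.implicativeBilattice (dual _⁺)
    (dual-relativelyComplemented _⁺ rc) (⊤ , ≤-refl)
    (λ (x , ⊤≤x) → sym (trans (∨-congˡ (trans ⊤≤x (∧-comm ⊤ x))) (∨-absorbs-∧ x ⊤)))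

  canonical : Carrier → DistributiveLattice.Carrier _⁻ × DistributiveLattice.Carrier _⁻
  canonical x = (x ∧ ⊤ , x∧y≤y x ⊤) , (¬ x ∧ ⊤ , x∧y≤y (¬ x) ⊤)

-- Write x ⊢ y for "x ⊃ y is trivial", which in 𝐀 means ⊤ ≤ x ⊃ y and in an
-- implicative bilattice means (x ⊃ y) ⊃ z ≈ z for all z.  In both structures ⊢ is
-- a preorder for which ⊃ residuates ∧, and an element x is determined, up to ≈, by
-- the ⊢-classes of x and ¬ x: these are its two coordinates in the square.
-- In 𝐀 one has x ⊢ y iff x ∧ ⊤ ≤ y, so (x ⊃ y) ∧ ⊤ is the pseudocomplement of x
-- relative to y in 𝐀⁻ and (RD3) makes it a complement.  The extension of f sends
-- ⟨ a , b ⟩ to f a ⊗ ¬ f b, the only element with coordinates f a and f b.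

module Submission where

open import Defs
open import Algebra.Lattice.Bundles using (DistributiveLattice; Lattice)
open import Algebra.Lattice.Morphism.Structures
  using (IsLatticeHomomorphism; IsLatticeMonomorphism; IsLatticeIsomorphism)
import Algebra.Lattice.Morphism.Construct.Identity as Identity
import Algebra.Lattice.Properties.DistributiveLattice as DistributiveLatticeProperties
import Algebra.Lattice.Properties.Lattice as LatticeProperties
open import Data.Product using (Σ-syntax; ∃; _×_; _,_; proj₁; proj₂; swap)
open import Function.Base using (id; _∘_)
open import Function.Definitions using (Injective)
open import Level using (Level; _⊔_)
open import Relation.Binary.Core using (Rel; _Preserves_⟶_)
open import Relation.Binary.Definitions using (Maximum)
import Relation.Binary.Construct.NaturalOrder.Left as NaturalOrder
import Relation.Binary.Lattice as Order
import Relation.Binary.Lattice.Properties.JoinSemilattice as JoinSemilatticeProperties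
import Relation.Binary.Reasoning.PartialOrder as ≤-Reasoning
import Relation.Binary.Reasoning.Setoid as ≈-Reasoning

private
  variable
    c c₁ c₂ ℓ ℓ₁ ℓ₂ ℓ₃ ℓ₄ : Level

-- Order isomorphisms and relative complements in lattices.

module _ (M : Order.MeetSemilattice c₁ ℓ₁ ℓ₂) (N : Order.MeetSemilattice c₂ ℓ₃ ℓ₄) where

  private
    module M = Order.MeetSemilattice M
    module N = Order.MeetSemilattice N

  -- `g` sends f x ∧ f y below both x and y. Applied to `¬_`, which is its own inverse, and to dual
  -- orders, this yields all the De Morgan laws below.
  orderIsomorphism⇒∧-homo :
    {f : M.Carrier → N.Carrier} {g : N.Carrier → M.Carrier} →
    f Preserves M._≤_ ⟶ N._≤_ → g Preserves N._≤_ ⟶ M._≤_ →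
    (∀ x → f (g x) N.≈ x) → (∀ x → g (f x) M.≈ x) →
    ∀ x y → f (x M.∧ y) N.≈ f x N.∧ f y
  orderIsomorphism⇒∧-homo {f} {g} f-mono g-mono f∘g g∘f x y = N.antisym
    (N.∧-greatest (f-mono (M.x∧y≤x x y)) (f-mono (M.x∧y≤y x y)))
    (N.trans (N.reflexive (N.Eq.sym (f∘g _))) (f-mono (M.∧-greatest
      (M.trans (g-mono (N.x∧y≤x _ _)) (M.reflexive (g∘f x)))
      (M.trans (g-mono (N.x∧y≤y _ _)) (M.reflexive (g∘f y))))))

module _ (L : DistributiveLattice c ℓ) where

  open DistributiveLattice L

  -- Cancellation, by distributing y ∧ (x ∨ z) and z ∧ (x ∨ y). It pins down `∖`, which is known
  -- only through its complement equations, and gives injectivity of the coordinates.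
  relativeComplement-unique : ∀ {x y z} → x ∧ y ≈ x ∧ z → x ∨ y ≈ x ∨ z → y ≈ z
  relativeComplement-unique {x} {y} {z} p q = begin
    y                  ≈⟨ ∧-absorbs-∨ y x ⟨
    y ∧ (y ∨ x)        ≈⟨ ∧-congˡ (trans (∨-comm y x) q) ⟩
    y ∧ (x ∨ z)        ≈⟨ ∧-distribˡ-∨ y x z ⟩
    y ∧ x ∨ y ∧ z      ≈⟨ ∨-cong (trans (trans (∧-comm y x) p) (∧-comm x z)) (∧-comm y z) ⟩
    z ∧ x ∨ z ∧ y      ≈⟨ ∧-distribˡ-∨ z x y ⟨
    z ∧ (x ∨ y)        ≈⟨ ∧-congˡ (trans q (∨-comm x z)) ⟩
    z ∧ (z ∨ x)        ≈⟨ ∧-absorbs-∨ z x ⟩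
    z                  ∎
    where
    open ≈-Reasoning setoid

-- Implication in a residuated De Morgan lattice.

module Residuated (𝐀 : ResiduatedDeMorganLattice c ℓ) where

  open ResiduatedDeMorganLattice 𝐀
  open DistributiveLattice distributiveLattice
    using (refl; sym; trans; setoid; ∧-cong; ∧-congˡ; ∧-congʳ; ∨-congˡ; ∧-comm;
           ∧-distribʳ-∨; ∨-distribˡ-∧; ∨-absorbs-∧)
  open DistributiveLatticeProperties distributiveLattice
    using (∧-idem; poset; ∨-∧-orderTheoreticLattice)
  open Order.Lattice ∨-∧-orderTheoreticLattice
    using (x∧y≤x; x∧y≤y; x≤x∨y; y≤x∨y; ∨-least; ∧-greatest; antisym;
           meetSemilattice; joinSemilattice)
    renaming (trans to ≤-trans; refl to ≤-refl; reflexive to ≤-reflexive)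

  ¬-distrib-∧ : ∀ x y → ¬ (x ∧ y) ≈ ¬ x ∨ ¬ y
  ¬-distrib-∧ = orderIsomorphism⇒∧-homo meetSemilattice
    (JoinSemilatticeProperties.dualMeetSemilattice joinSemilattice)
    ¬-antitone ¬-antitone ¬-involutive ¬-involutive

  ¬-distrib-∨ : ∀ x y → ¬ (x ∨ y) ≈ ¬ x ∧ ¬ y
  ¬-distrib-∨ = orderIsomorphism⇒∧-homo
    (JoinSemilatticeProperties.dualMeetSemilattice joinSemilattice) meetSemilattice
    ¬-antitone ¬-antitone ¬-involutive ¬-involutive

  ¬-injective : ∀ {x y} → ¬ x ≈ ¬ y → x ≈ y
  ¬-injective p = trans (sym (¬-involutive _)) (trans (¬-cong p) (¬-involutive _))

  ≤⊤⇒⊤≤¬ : ∀ {x} → x ≤ ⊤ → ⊤ ≤ ¬ x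
  ≤⊤⇒⊤≤¬ x≤⊤ = ≤-trans (≤-reflexive RD0) (¬-antitone x≤⊤)

  ⊤≤⇒¬≤⊤ : ∀ {x} → ⊤ ≤ x → ¬ x ≤ ⊤
  ⊤≤⇒¬≤⊤ ⊤≤x = ≤-trans (¬-antitone ⊤≤x) (≤-reflexive (sym RD0))

  ⊃-antitone : ∀ {x y} z → x ≤ y → y ⊃ z ≤ x ⊃ z
  ⊃-antitone {x} {y} z x≤y = begin
    y ⊃ z              ≈⟨ ⊃-cong (antisym (y≤x∨y x y) (∨-least x≤y ≤-refl)) refl ⟩
    (x ∨ y) ⊃ z        ≈⟨ RD4 x y z ⟩
    (x ⊃ z) ∧ (y ⊃ z)  ≤⟨ x∧y≤x _ _ ⟩
    x ⊃ z              ∎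
    where open ≤-Reasoning poset

  ⊤≤⇒⊃-trivial : ∀ {x} z → ⊤ ≤ x → x ⊃ z ≈ z
  ⊤≤⇒⊃-trivial {x} z ⊤≤x = begin
    x ⊃ z        ≈⟨ RD1 _ ⟨
    ⊤ ⊃ (x ⊃ z)  ≈⟨ RD2 ⊤ x z ⟩
    (⊤ ∧ x) ⊃ z  ≈⟨ ⊃-cong (sym ⊤≤x) refl ⟩
    ⊤ ⊃ z        ≈⟨ RD1 z ⟩
    z            ∎
    where open ≈-Reasoning setoid

  ∧⊤-⊃ : ∀ x z → (x ∧ ⊤) ⊃ z ≈ x ⊃ z
  ∧⊤-⊃ x z = trans (sym (RD2 x ⊤ z)) (⊃-cong refl (RD1 z))

  peirce : ∀ x y → ⊤ ≤ ((x ⊃ y) ⊃ x) ⊃ x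
  peirce x y = sym (RD3 x y)

  -- With u = y ⊃ ⊤, (RD5) and (RD6) give ¬ u ≤ u ⊃ ⊤, hence (u ⊃ ⊤) ⊃ ⊤ ≤ ¬ u ⊃ ⊤ ≈ u.
  ⊤≤⊃⊤ : ∀ y → ⊤ ≤ y ⊃ ⊤
  ⊤≤⊃⊤ y = begin
    ⊤                  ≤⟨ peirce ⊤ u ⟩
    ((⊤ ⊃ u) ⊃ ⊤) ⊃ ⊤  ≈⟨ ⊃-cong (⊃-cong (RD1 u) refl) refl ⟩
    (u ⊃ ⊤) ⊃ ⊤        ≤⟨ ⊃-antitone ⊤ ¬u≤u⊃⊤ ⟩
    ¬ u ⊃ ⊤            ≈⟨ ¬u⊃⊤≈u ⟩
    u                  ∎
    where
    open ≤-Reasoning poset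
    u = y ⊃ ⊤
    ¬u⊃⊤≈u : ¬ u ⊃ ⊤ ≈ u
    ¬u⊃⊤≈u = begin-equality
      ¬ u ⊃ ⊤        ≈⟨ RD6 y ⊤ ⊤ ⟩
      (y ∧ ¬ ⊤) ⊃ ⊤  ≈⟨ ⊃-cong (∧-congˡ (sym RD0)) refl ⟩
      (y ∧ ⊤) ⊃ ⊤    ≈⟨ ∧⊤-⊃ y ⊤ ⟩
      u              ∎
    ¬u≤u⊃⊤ : ¬ u ≤ u ⊃ ⊤
    ¬u≤u⊃⊤ = begin
      ¬ u                                ≈⟨ RD5 (¬ u) ⊤ ⟨
      ¬ u ∧ (((¬ u ⊃ ⊤) ∧ (¬ ⊤ ⊃ ¬ ¬ u)) ⊃ ⊤)  ≤⟨ x∧y≤y _ _ ⟩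
      ((¬ u ⊃ ⊤) ∧ (¬ ⊤ ⊃ ¬ ¬ u)) ⊃ ⊤    ≈⟨ ⊃-cong (∧-cong ¬u⊃⊤≈u
                                            (trans (⊃-cong (sym RD0) (¬-involutive u)) (RD1 u)))
                                            refl ⟩
      (u ∧ u) ⊃ ⊤                        ≈⟨ ⊃-cong (∧-idem u) refl ⟩
      u ⊃ ⊤                              ∎

  -- (RD5) at `⊤` yields y ⊃ y behind the premise ¬ y ⊃ ⊤, and `⊤≤⊃⊤` discharges that premise.
  ⊃-self : ∀ y → ⊤ ≤ y ⊃ y
  ⊃-self y = begin
    ⊤                              ≤⟨ sym (RD5 ⊤ y) ⟩
    ((⊤ ⊃ y) ∧ (¬ y ⊃ ¬ ⊤)) ⊃ y    ≈⟨ ⊃-cong (∧-comm _ _) refl ⟩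
    ((¬ y ⊃ ¬ ⊤) ∧ (⊤ ⊃ y)) ⊃ y    ≈⟨ ⊃-cong (∧-cong (⊃-cong refl (sym RD0)) (RD1 y)) refl ⟩
    ((¬ y ⊃ ⊤) ∧ y) ⊃ y            ≈⟨ RD2 _ y y ⟨
    (¬ y ⊃ ⊤) ⊃ (y ⊃ y)            ≈⟨ ⊤≤⇒⊃-trivial _ (⊤≤⊃⊤ (¬ y)) ⟩
    y ⊃ y                          ∎
    where open ≤-Reasoning poset

  ∧⊤≤⇒⊤≤⊃ : ∀ {x y} → x ∧ ⊤ ≤ y → ⊤ ≤ x ⊃ y
  ∧⊤≤⇒⊤≤⊃ {x} {y} p =
    ≤-trans (⊃-self y) (≤-trans (⊃-antitone y p) (≤-reflexive (∧⊤-⊃ x y)))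

  -- (RD5) also demands the contrapositive implication. Cutting x down to x ∧ ⊤ makes it trivial,
  -- because its conclusion ¬ (x ∧ ⊤) then lies above `⊤`.
  ⊤≤⊃⇒∧⊤≤ : ∀ {x y} → ⊤ ≤ x ⊃ y → x ∧ ⊤ ≤ y
  ⊤≤⊃⇒∧⊤≤ {x} {y} p = begin
    x ∧ ⊤                                          ≤⟨ sym (RD5 (x ∧ ⊤) y) ⟩
    (((x ∧ ⊤) ⊃ y) ∧ (¬ y ⊃ ¬ (x ∧ ⊤))) ⊃ y        ≈⟨ ⊤≤⇒⊃-trivial y (∧-greatest
      (≤-trans p (≤-reflexive (sym (∧⊤-⊃ x y))))
      (∧⊤≤⇒⊤≤⊃ (≤-trans (x∧y≤y _ _) (≤⊤⇒⊤≤¬ (x∧y≤y x ⊤))))) ⟩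
    y                                              ∎
    where open ≤-Reasoning poset

  residual : ∀ {x y z} → (z ∧ x) ∧ ⊤ ≤ y → z ∧ ⊤ ≤ x ⊃ y
  residual {x} {y} {z} p =
    ⊤≤⊃⇒∧⊤≤ (≤-trans (∧⊤≤⇒⊤≤⊃ p) (≤-reflexive (sym (RD2 z x y))))

  modus-ponens : ∀ x y → ((x ⊃ y) ∧ x) ∧ ⊤ ≤ y
  modus-ponens x y = ⊤≤⊃⇒∧⊤≤ (≤-trans (⊃-self (x ⊃ y)) (≤-reflexive (RD2 _ x y)))

  -- Relative complements below and above `⊤`.

  excluded-middle : ∀ x y → ⊤ ≤ x ∨ (x ⊃ y)
  -- Peirce's law for w = x ∨ (x ⊃ y): its premise (w ⊃ y) ⊃ w is trivial, since w ⊃ y ≤ x ⊃ y ≤ w,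
  -- so w itself lies above `⊤`.
  excluded-middle x y = ≤-trans (peirce w y) (≤-reflexive (⊤≤⇒⊃-trivial w
    (∧⊤≤⇒⊤≤⊃ (≤-trans (x∧y≤x _ _) (≤-trans (⊃-antitone y (x≤x∨y x _)) (y≤x∨y x _))))))
    where w = x ∨ (x ⊃ y)

  -- The pseudocomplement x ⊃ u is truncated at v to stay in the interval. Residuation gives the
  -- meet; excluded middle and distributivity give the join.
  relativeComplement : ∀ {u v x} → u ≤ x → x ≤ v → v ≤ ⊤ →
    (x ∧ ((x ⊃ u) ∧ v) ≈ u) × (x ∨ ((x ⊃ u) ∧ v) ≈ v)
  relativeComplement {u} {v} {x} u≤x x≤v v≤⊤ =
    antisym
      (≤-trans (∧-greatest
        (∧-greatest (≤-trans (x∧y≤y _ _) (x∧y≤x _ _)) (x∧y≤x _ _))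
        (≤-trans (x∧y≤x _ _) x≤⊤)) (modus-ponens x u))
      (∧-greatest u≤x (∧-greatest
        (≤-trans (∧-greatest ≤-refl (≤-trans u≤x x≤⊤))
          (residual (≤-trans (x∧y≤x _ _) (x∧y≤x _ _))))
        (≤-trans u≤x x≤v)))
    , antisym
      (∨-least x≤v (x∧y≤y _ _))
      (≤-trans (∧-greatest (≤-trans v≤⊤ (excluded-middle x u)) (y≤x∨y x v))
        (≤-reflexive (sym (∨-distribˡ-∧ x _ v))))
    where
    x≤⊤ = ≤-trans x≤v v≤⊤

  relativelyComplemented⁻ : RelativelyComplemented (𝐀 ⁻)
  relativelyComplemented⁻ (u , _) (v , v≤⊤) (x , _) u≤x x≤v =
    ((x ⊃ u) ∧ v , ≤-trans (x∧y≤y _ v) v≤⊤) , relativeComplement u≤x x≤v v≤⊤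

  -- Negation carries the interval from u to v to the one from ¬ v to ¬ u inside `𝐀 ⁻`. A complement
  -- found there is negated back, and the two equations change places.
  relativelyComplemented⁺ : RelativelyComplemented (𝐀 ⁺)
  relativelyComplemented⁺ (u , ⊤≤u) (v , ⊤≤v) (x , ⊤≤x) u≤x x≤v =
    let (y , y≤⊤) , ¬x∧y , ¬x∨y = relativelyComplemented⁻
          (¬ v , ⊤≤⇒¬≤⊤ ⊤≤v) (¬ u , ⊤≤⇒¬≤⊤ ⊤≤u) (¬ x , ⊤≤⇒¬≤⊤ ⊤≤x)
          (¬-antitone x≤v) (¬-antitone u≤x)
    in (¬ y , ≤⊤⇒⊤≤¬ y≤⊤)
     , ¬-injective (trans (¬-distrib-∧ x (¬ y)) (trans (∨-congˡ (¬-involutive y)) ¬x∨y))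
     , ¬-injective (trans (¬-distrib-∨ x (¬ y)) (trans (∧-congˡ (¬-involutive y)) ¬x∧y))

  -- Negation as the dual isomorphism.

  ¬⁺ : DistributiveLattice.Carrier (𝐀 ⁻) → DistributiveLattice.Carrier (𝐀 ⁺)
  ¬⁺ (x , x≤⊤) = ¬ x , ≤⊤⇒⊤≤¬ x≤⊤

  ¬⁺-isLatticeIsomorphism : IsLatticeIsomorphism
    (DistributiveLattice.rawLattice (𝐀 ⁻)) (DistributiveLattice.rawLattice (dual (𝐀 ⁺))) ¬⁺
  ¬⁺-isLatticeIsomorphism = record
    { isLatticeMonomorphism = record
      { isLatticeHomomorphism = record
        { isRelHomomorphism = record { cong = ¬-cong }
        ; ∧-homo            = λ (x , _) (y , _) → ¬-distrib-∧ x y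
        ; ∨-homo            = λ (x , _) (y , _) → ¬-distrib-∨ x y
        }
      ; injective = ¬-injective
      }
    ; surjective = λ (y , ⊤≤y) →
        (¬ y , ⊤≤⇒¬≤⊤ ⊤≤y) , λ x≈¬y → trans (¬-cong x≈¬y) (¬-involutive y)
    }

  -- Coordinates of elements of `𝐀` and the embeddings into the squares.

  pos : Carrier → DistributiveLattice.Carrier (𝐀 ⁻)
  pos x = x ∧ ⊤ , x∧y≤y x ⊤

  ∧⊤-∧ : ∀ x y → (x ∧ y) ∧ ⊤ ≈ (x ∧ ⊤) ∧ (y ∧ ⊤)
  ∧⊤-∧ x y = antisym
    (∧-greatest (∧-greatest (≤-trans (x∧y≤x _ _) (x∧y≤x _ _)) (x∧y≤y _ _))
                (∧-greatest (≤-trans (x∧y≤x _ _) (x∧y≤y _ _)) (x∧y≤y _ _)))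
    (∧-greatest (∧-greatest (≤-trans (x∧y≤x _ _) (x∧y≤x _ _)) (≤-trans (x∧y≤y _ _) (x∧y≤x _ _)))
                (≤-trans (x∧y≤x _ _) (x∧y≤y _ _)))

  -- Instances z = y and z = x of the hypothesis suffice. This turns (RD6), which compares elements
  -- only as antecedents, into an equation in `𝐀 ⁻`.
  ⊃-equivalent⇒∧⊤-≈ : ∀ {x y} → (∀ z → x ⊃ z ≈ y ⊃ z) → x ∧ ⊤ ≈ y ∧ ⊤
  ⊃-equivalent⇒∧⊤-≈ {x} {y} p = antisym
    (∧-greatest (⊤≤⊃⇒∧⊤≤ (≤-trans (⊃-self y) (≤-reflexive (sym (p y))))) (x∧y≤y _ _))
    (∧-greatest (⊤≤⊃⇒∧⊤≤ (≤-trans (⊃-self x) (≤-reflexive (p x)))) (x∧y≤y _ _))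

  ∧⊤-¬⊃ : ∀ x y → ¬ (x ⊃ y) ∧ ⊤ ≈ (x ∧ ⊤) ∧ (¬ y ∧ ⊤)
  ∧⊤-¬⊃ x y = trans (⊃-equivalent⇒∧⊤-≈ (RD6 x y)) (∧⊤-∧ x (¬ y))

  -- Together with `∧⊤-∨⊃` this makes (x ⊃ y) ∧ ⊤ satisfy the equations that define `∖` on the first
  -- coordinates.
  ∧⊤-∧⊃ : ∀ x y → (x ∧ ⊤) ∧ ((x ⊃ y) ∧ ⊤) ≈ (x ∧ ⊤) ∧ (y ∧ ⊤)
  ∧⊤-∧⊃ x y = antisym
    (∧-greatest (x∧y≤x _ _) (∧-greatest
      (≤-trans (∧-greatest
        (∧-greatest (≤-trans (x∧y≤y _ _) (x∧y≤x _ _)) (≤-trans (x∧y≤x _ _) (x∧y≤x _ _)))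
        (≤-trans (x∧y≤x _ _) (x∧y≤y _ _))) (modus-ponens x y))
      (≤-trans (x∧y≤x _ _) (x∧y≤y _ _))))
    (∧-greatest (x∧y≤x _ _) (≤-trans (x∧y≤y _ _) (∧-greatest
      (residual (≤-trans (x∧y≤x _ _) (x∧y≤x _ _))) (x∧y≤y _ _))))

  ∧⊤-∨⊃ : ∀ x y → (x ∧ ⊤) ∨ ((x ⊃ y) ∧ ⊤) ≈ ⊤
  ∧⊤-∨⊃ x y = antisym (∨-least (x∧y≤y _ _) (x∧y≤y _ _))
    (≤-trans (∧-greatest (excluded-middle x y) ≤-refl) (≤-reflexive (∧-distribʳ-∨ ⊤ x _)))

  -- As ¬ ⊤ ≈ ⊤, the second hypothesis is the negation of ⊤ ∨ x ≈ ⊤ ∨ y, so x and y are both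
  -- complements of `⊤` in one interval.
  ∧⊤-injective : ∀ {x y} → x ∧ ⊤ ≈ y ∧ ⊤ → ¬ x ∧ ⊤ ≈ ¬ y ∧ ⊤ → x ≈ y
  ∧⊤-injective {x} {y} p q = relativeComplement-unique distributiveLattice
    (trans (∧-comm ⊤ x) (trans p (∧-comm y ⊤)))
    (¬-injective (begin
      ¬ (⊤ ∨ x)      ≈⟨ ¬-distrib-∨ ⊤ x ⟩
      ¬ ⊤ ∧ ¬ x      ≈⟨ trans (∧-congʳ (sym RD0)) (∧-comm ⊤ _) ⟩
      ¬ x ∧ ⊤        ≈⟨ q ⟩
      ¬ y ∧ ⊤        ≈⟨ trans (∧-comm _ ⊤) (∧-congʳ RD0) ⟩
      ¬ ⊤ ∧ ¬ y      ≈⟨ ¬-distrib-∨ ⊤ y ⟨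
      ¬ (⊤ ∨ y)      ∎))
    where open ≈-Reasoning setoid

  -- One argument serves both squares: `e` is the identity for `𝐀 ⁻` and negation for the dual of
  -- `𝐀 ⁺`.
  module Embedding
    (L : DistributiveLattice c₁ ℓ₁)
    (rc : RelativelyComplemented L)
    (1# : DistributiveLattice.Carrier L)
    (maximum : Maximum (NaturalOrder._≤_ (DistributiveLattice._≈_ L) (DistributiveLattice._∧_ L)) 1#)
    (e : DistributiveLattice.Carrier (𝐀 ⁻) → DistributiveLattice.Carrier L)
    (e-mono : IsLatticeMonomorphism
      (DistributiveLattice.rawLattice (𝐀 ⁻)) (DistributiveLattice.rawLattice L) e)
    (e-⊤ : DistributiveLattice._≈_ L (e (⊤ , ≤-refl)) 1#)
    where

    private
      module L = DistributiveLattice L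
      module S = Square L rc 1# maximum
      open IsLatticeMonomorphism e-mono renaming
        (∧-homo to e-∧; ∨-homo to e-∨; ⟦⟧-cong to e-cong; injective to e-injective)

    open L using () renaming (_≈_ to _≈ᴸ_; _∧_ to _⊓_; _∨_ to _⊔ᴸ_)

    embed : Carrier → L.Carrier × L.Carrier
    embed x = e (pos x) , e (pos (¬ x))

    embed-∧ : ∀ x y → embed (x ∧ y) S.≋ (embed x S.∧ embed y)
    embed-∧ x y =
        L.trans (e-cong (∧⊤-∧ x y)) (e-∧ _ _)
      , L.trans (e-cong (trans (∧-congʳ (¬-distrib-∧ x y)) (∧-distribʳ-∨ ⊤ _ _))) (e-∨ _ _)

    embed-∨ : ∀ x y → embed (x ∨ y) S.≋ (embed x S.∨ embed y)
    embed-∨ x y =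
        L.trans (e-cong (∧-distribʳ-∨ ⊤ x y)) (e-∨ _ _)
      , L.trans (e-cong (trans (∧-congʳ (¬-distrib-∨ x y)) (∧⊤-∧ _ _))) (e-∧ _ _)

    embed-⊃ : ∀ x y → embed (x ⊃ y) S.≋ (embed x S.⊃ embed y)
    embed-⊃ x y =
        -- `∖` is whichever complement `rc` supplies, so uniqueness of complements is what
        -- identifies it with the image of x ⊃ y.
        relativeComplement-unique L {x = e (pos x)}
          (begin
            e (pos x) ⊓ e (pos (x ⊃ y))  ≈⟨ e-∧ _ _ ⟨
            e _                          ≈⟨ e-cong (∧⊤-∧⊃ x y) ⟩
            e _                          ≈⟨ e-∧ _ _ ⟩
            e (pos x) ⊓ e (pos y)        ≈⟨ proj₁ (proj₂ complement) ⟨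
            e (pos x) ⊓ proj₁ complement ∎)
          (begin
            e (pos x) ⊔ᴸ e (pos (x ⊃ y))  ≈⟨ e-∨ _ _ ⟨
            e _                           ≈⟨ e-cong (∧⊤-∨⊃ x y) ⟩
            e (⊤ , ≤-refl)                ≈⟨ e-⊤ ⟩
            1#                            ≈⟨ proj₂ (proj₂ complement) ⟨
            e (pos x) ⊔ᴸ proj₁ complement ∎)
      , L.trans (e-cong (∧⊤-¬⊃ x y)) (e-∧ _ _)
      where
      open ≈-Reasoning L.setoid
      complement = S.complement (e (pos x)) (e (pos y))

    embed-⊤ : ∀ x → embed ⊤ S.≋ ImplicativeBilattice.⊤[_] S.implicativeBilattice x
    embed-⊤ (x₁ , x₂) =
        L.trans 1≈ (L.sym 1∨)
      , L.trans (L.trans (e-cong (∧-congʳ (sym RD0))) 1≈) (L.trans (L.sym 1∨) (L.∨-comm _ _))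
      where
      1≈ : e (pos ⊤) ≈ᴸ 1#
      1≈ = L.trans (e-cong (∧-idem ⊤)) e-⊤
      1∨ : ((x₁ S.∖ x₁) ⊔ᴸ (x₁ ⊓ x₂)) ≈ᴸ 1#
      1∨ = begin
        (x₁ S.∖ x₁) ⊔ᴸ (x₁ ⊓ x₂)  ≈⟨ L.∨-cong (S.∖-self x₁)
                                      (L.trans (maximum (x₁ ⊓ x₂)) (L.∧-comm _ _)) ⟩
        1# ⊔ᴸ (1# ⊓ (x₁ ⊓ x₂))    ≈⟨ L.∨-absorbs-∧ 1# _ ⟩
        1#                        ∎
        where open ≈-Reasoning L.setoid

    embed-isResiduatedEmbedding : IsResiduatedEmbedding 𝐀 S.implicativeBilattice embed
    embed-isResiduatedEmbedding = record
      { isResiduatedHomomorphism = record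
        { isLatticeHomomorphism = record
          { isRelHomomorphism = record
            { cong = λ p → e-cong (∧-congʳ p) , e-cong (∧-congʳ (¬-cong p)) }
          ; ∧-homo = embed-∧
          ; ∨-homo = embed-∨
          }
        ; ⊃-homo = embed-⊃
        ; ¬-homo = λ x → L.refl , e-cong (∧-congʳ (¬-involutive x))
        ; ⊤-homo = embed-⊤
        }
      ; injective = λ (p , q) → ∧⊤-injective (e-injective p) (e-injective q)
      }

  ∧⊤-absorbs-⊤≤ : ∀ {x y} → x ≤ ⊤ → ⊤ ≤ y → x ≈ (x ∧ ⊤) ∧ (y ∧ ⊤)
  ∧⊤-absorbs-⊤≤ x≤⊤ ⊤≤y = antisym
    (∧-greatest (∧-greatest ≤-refl x≤⊤) (∧-greatest (≤-trans x≤⊤ ⊤≤y) x≤⊤))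
    (≤-trans (x∧y≤x _ _) (x∧y≤x _ _))

  -- The image of `canonical` generates the square under `⊗`, whence uniqueness of the extension.
  -- Both ¬ a and ¬ b lie above `⊤`, so they disappear from the meets.
  canonical-generates : (rc : RelativelyComplemented (𝐀 ⁻)) →
    let open ImplicativeBilattice (square⁻ 𝐀 rc) renaming (_≈_ to _≋_) using (_⊗_) in
    ∀ a b → (a , b) ≋ (canonical 𝐀 (proj₁ a) ⊗ canonical 𝐀 (¬ (proj₁ b)))
  canonical-generates rc (a , a≤⊤) (b , b≤⊤) =
      ∧⊤-absorbs-⊤≤ a≤⊤ (≤⊤⇒⊤≤¬ b≤⊤)
    , trans (∧⊤-absorbs-⊤≤ b≤⊤ (≤⊤⇒⊤≤¬ a≤⊤))
        (trans (∧-comm _ _) (∧-congˡ (∧-congʳ (sym (¬-involutive b)))))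

  canonical-isResiduatedEmbedding :
    IsResiduatedEmbedding 𝐀 (square⁻ 𝐀 relativelyComplemented⁻) (canonical 𝐀)
  canonical-isResiduatedEmbedding = Embedding.embed-isResiduatedEmbedding
    (𝐀 ⁻) relativelyComplemented⁻ (⊤ , ≤-refl) proj₂ id
    (Identity.isLatticeMonomorphism _ refl) refl

  -- Up to `≈` the map sends x to ⟨ ¬ x ∨ ⊤ , x ∨ ⊤ ⟩.
  embedding⁺ : ∃ (IsResiduatedEmbedding 𝐀 (square⁺ 𝐀 relativelyComplemented⁺))
  embedding⁺ = embed , embed-isResiduatedEmbedding
    where
    open Embedding (dual (𝐀 ⁺)) (dual-relativelyComplemented (𝐀 ⁺) relativelyComplemented⁺)
      (⊤ , ≤-refl)
      (λ (x , ⊤≤x) → sym (trans (∨-congˡ (trans ⊤≤x (∧-comm ⊤ x))) (∨-absorbs-∧ x ⊤)))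
      ¬⁺ (IsLatticeIsomorphism.isLatticeMonomorphism ¬⁺-isLatticeIsomorphism) (sym RD0)

-- Entailment in an implicative bilattice.

module Implicative (𝐁 : ImplicativeBilattice c ℓ) where

  open ImplicativeBilattice 𝐁
  private
    module K = Lattice latticeₖ
    module T≤ = Order.Lattice (LatticeProperties.∨-∧-orderTheoreticLattice latticeₜ)
    module K≤ = Order.Lattice (LatticeProperties.∨-∧-orderTheoreticLattice latticeₖ)
  open Lattice latticeₜ using (refl; sym; trans; setoid)

  ¬-distrib-∧ : ∀ x y → ¬ (x ∧ y) ≈ ¬ x ∨ ¬ y
  ¬-distrib-∧ = orderIsomorphism⇒∧-homo T≤.meetSemilattice
    (JoinSemilatticeProperties.dualMeetSemilattice T≤.joinSemilattice)
    ¬-antitoneₜ ¬-antitoneₜ ¬-involutive ¬-involutive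

  ¬-distrib-∨ : ∀ x y → ¬ (x ∨ y) ≈ ¬ x ∧ ¬ y
  ¬-distrib-∨ = orderIsomorphism⇒∧-homo
    (JoinSemilatticeProperties.dualMeetSemilattice T≤.joinSemilattice) T≤.meetSemilattice
    ¬-antitoneₜ ¬-antitoneₜ ¬-involutive ¬-involutive

  ¬-distrib-⊗ : ∀ x y → ¬ (x ⊗ y) ≈ ¬ x ⊗ ¬ y
  ¬-distrib-⊗ = orderIsomorphism⇒∧-homo K≤.meetSemilattice K≤.meetSemilattice
    ¬-monotoneₖ ¬-monotoneₖ ¬-involutive ¬-involutive

  ¬-distrib-⊕ : ∀ x y → ¬ (x ⊕ y) ≈ ¬ x ⊕ ¬ y
  ¬-distrib-⊕ = orderIsomorphism⇒∧-homo
    (JoinSemilatticeProperties.dualMeetSemilattice K≤.joinSemilattice)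
    (JoinSemilatticeProperties.dualMeetSemilattice K≤.joinSemilattice)
    ¬-monotoneₖ ¬-monotoneₖ ¬-involutive ¬-involutive

  -- With no constant to compare with, triviality is acting as a left identity of `⊃`. In the square
  -- this holds of ⟨ a , b ⟩ exactly when a is the maximum.
  Dense : Carrier → Set (c ⊔ ℓ)
  Dense x = ∀ y → x ⊃ y ≈ y

  Dense-cong : ∀ {x y} → x ≈ y → Dense x → Dense y
  Dense-cong x≈y dx z = trans (⊃-cong (sym x≈y) refl) (dx z)

  Dense-∧ : ∀ {x y} → Dense x → Dense y → Dense (x ∧ y)
  Dense-∧ dx dy z = trans (sym (IB2-∧ _ _ z)) (trans (dx _) (dy z))

  Dense-upₜ : ∀ {x y} → x ≤ₜ y → Dense x → Dense y
  Dense-upₜ {x} {y} x≤y dx z = begin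
    y ⊃ z        ≈⟨ dx _ ⟨
    x ⊃ (y ⊃ z)  ≈⟨ IB2-∧ x y z ⟩
    (x ∧ y) ⊃ z  ≈⟨ ⊃-cong (sym x≤y) refl ⟩
    x ⊃ z        ≈⟨ dx z ⟩
    z            ∎
    where open ≈-Reasoning setoid

  ⊃-antitoneₜ : ∀ {x y} z → x ≤ₜ y → y ⊃ z ≤ₜ x ⊃ z
  ⊃-antitoneₜ {x} {y} z x≤y = T≤.trans
    (T≤.reflexive (trans
      (⊃-cong (T≤.antisym (T≤.y≤x∨y x y) (T≤.∨-least x≤y T≤.refl)) refl)
      (IB4-∨ x y z)))
    (T≤.x∧y≤x _ _)

  -- (IB4) lets `⊕` take the place of `∨`: antecedents are compared in `≤ₖ`, yet the implications in
  -- `≤ₜ`.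
  ⊃-antitoneₖ : ∀ {x y} z → x ≤ₖ y → y ⊃ z ≤ₜ x ⊃ z
  ⊃-antitoneₖ {x} {y} z x≤y = T≤.trans
    (T≤.reflexive (trans
      (⊃-cong (K≤.antisym (K≤.y≤x∨y x y) (K≤.∨-least x≤y K≤.refl)) refl)
      (sym (IB4-⊕ x y z))))
    (T≤.x∧y≤x _ _)

  infix 4 _⊢_ _⊣⊢_

  _⊢_ : Rel Carrier (c ⊔ ℓ)
  x ⊢ y = Dense (x ⊃ y)

  _⊣⊢_ : Rel Carrier (c ⊔ ℓ)
  x ⊣⊢ y = x ⊢ y × y ⊢ x

  ⊢-refl : ∀ {x} → x ⊢ x
  ⊢-refl {x} = IB1 x

  ≤ₜ⇒⊢ : ∀ {x y} → x ≤ₜ y → x ⊢ y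
  ≤ₜ⇒⊢ x≤y = Dense-upₜ (⊃-antitoneₜ _ x≤y) ⊢-refl

  ≤ₖ⇒⊢ : ∀ {x y} → x ≤ₖ y → x ⊢ y
  ≤ₖ⇒⊢ x≤y = Dense-upₜ (⊃-antitoneₖ _ x≤y) ⊢-refl

  ⊢⇒≤ₜ⊗ : ∀ {x y} → x ⊢ y → x ≤ₜ x ⊗ y
  ⊢⇒≤ₜ⊗ {x} {y} x⊢y = T≤.trans (sym (IB5 x y)) (T≤.reflexive (x⊢y _))

  -- The route passes through x ⊗ y, which is above x in `≤ₜ` by (IB5) and below y in `≤ₖ`; `⊃` is
  -- antitone for both orders.
  ⊢-trans : ∀ {x y z} → x ⊢ y → y ⊢ z → x ⊢ z
  ⊢-trans x⊢y y⊢z = Dense-upₜ (⊃-antitoneₜ _ (⊢⇒≤ₜ⊗ x⊢y))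
    (Dense-upₜ (⊃-antitoneₖ _ (K≤.x∧y≤y _ _)) y⊢z)

  ⊢-curry : ∀ {x y z} → x ∧ y ⊢ z → x ⊢ y ⊃ z
  ⊢-curry = Dense-cong (sym (IB2-∧ _ _ _))

  ⊢-uncurry : ∀ {x y z} → x ⊢ y ⊃ z → x ∧ y ⊢ z
  ⊢-uncurry = Dense-cong (IB2-∧ _ _ _)

  -- (IB5) is used twice, to reach x ⊗ y and then (x ⊗ y) ⊗ z, which is below y ⊗ z in `≤ₖ`.
  ⊢-⊗ : ∀ {x y z} → x ⊢ y → x ⊢ z → x ⊢ y ⊗ z
  ⊢-⊗ {x} {y} {z} x⊢y x⊢z = ⊢-trans (≤ₜ⇒⊢ (⊢⇒≤ₜ⊗ x⊢y))
    (⊢-trans (≤ₜ⇒⊢ (⊢⇒≤ₜ⊗ (⊢-trans (≤ₖ⇒⊢ (K≤.x∧y≤x x y)) x⊢z)))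
      (≤ₖ⇒⊢ (K≤.∧-greatest (K≤.trans (K≤.x∧y≤x _ _) (K≤.x∧y≤y x y)) (K≤.x∧y≤y _ z))))

  -- By (IB2) both elements have the same implications out of them, in particular into each other.
  ⊗⊣⊢∧ : ∀ x y → x ⊗ y ⊣⊢ x ∧ y
  ⊗⊣⊢∧ x y = Dense-cong (IB2-⊗ _ _ _) ⊢-refl , Dense-cong (sym (IB2-⊗ _ _ _)) ⊢-refl

  ⊢-∧ : ∀ {x y z} → x ⊢ y → x ⊢ z → x ⊢ y ∧ z
  ⊢-∧ x⊢y x⊢z = ⊢-trans (⊢-⊗ x⊢y x⊢z) (proj₁ (⊗⊣⊢∧ _ _))

  ∧⊢ˡ : ∀ {x y} → x ∧ y ⊢ x
  ∧⊢ˡ = ≤ₜ⇒⊢ (T≤.x∧y≤x _ _)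

  ∧⊢ʳ : ∀ {x y} → x ∧ y ⊢ y
  ∧⊢ʳ = ≤ₜ⇒⊢ (T≤.x∧y≤y _ _)

  ∨-⊢ : ∀ {x y z} → x ⊢ z → y ⊢ z → x ∨ y ⊢ z
  ∨-⊢ x⊢z y⊢z = Dense-cong (sym (IB4-∨ _ _ _)) (Dense-∧ x⊢z y⊢z)

  ⊢∨ˡ : ∀ {x y} → x ⊢ x ∨ y
  ⊢∨ˡ = ≤ₜ⇒⊢ (T≤.x≤x∨y _ _)

  ⊢∨ʳ : ∀ {x y} → y ⊢ x ∨ y
  ⊢∨ʳ = ≤ₜ⇒⊢ (T≤.y≤x∨y _ _)

  ⊕⊣⊢∨ : ∀ x y → x ⊕ y ⊣⊢ x ∨ y
  ⊕⊣⊢∨ x y =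
      Dense-cong (IB4-⊕ _ _ _) (Dense-∧ ⊢∨ˡ ⊢∨ʳ)
    , ∨-⊢ (≤ₖ⇒⊢ (K≤.x≤x∨y x y)) (≤ₖ⇒⊢ (K≤.y≤x∨y x y))

  ⊃-⊢ : ∀ {x y} → (x ⊃ y) ∧ x ⊢ y
  ⊃-⊢ = ⊢-uncurry ⊢-refl

  -- Every x entails y ⊃ y, and by (IB1) the element (y ⊃ y) ⊃ y is just y.
  Dense-⊢ : ∀ {x y} → Dense y → x ⊢ y
  Dense-⊢ {y = y} dy = ⊢-trans (⊢-curry ∧⊢ʳ) (Dense-cong (sym (IB1 y y)) dy)

  ⊣⊢-refl : ∀ {x} → x ⊣⊢ x
  ⊣⊢-refl = ⊢-refl , ⊢-refl

  ⊣⊢-reflexive : ∀ {x y} → x ≈ y → x ⊣⊢ y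
  ⊣⊢-reflexive p = ≤ₜ⇒⊢ (T≤.reflexive p) , ≤ₜ⇒⊢ (T≤.reflexive (sym p))

  ⊣⊢-trans : ∀ {x y z} → x ⊣⊢ y → y ⊣⊢ z → x ⊣⊢ z
  ⊣⊢-trans (p , p′) (q , q′) = ⊢-trans p q , ⊢-trans q′ p′

  ∧-identityˡ-⊣⊢ : ∀ {x y} → Dense x → x ∧ y ⊣⊢ y
  ∧-identityˡ-⊣⊢ dx = ∧⊢ʳ , ⊢-∧ (Dense-⊢ dx) ⊢-refl

  ∧-identityʳ-⊣⊢ : ∀ {x y} → Dense y → x ∧ y ⊣⊢ x
  ∧-identityʳ-⊣⊢ dy = ∧⊢ˡ , ⊢-∧ ⊢-refl (Dense-⊢ dy)

  ∧-cong-⊣⊢ : ∀ {x x′ y y′} → x ⊣⊢ x′ → y ⊣⊢ y′ → x ∧ y ⊣⊢ x′ ∧ y′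
  ∧-cong-⊣⊢ (p , p′) (q , q′) =
      ⊢-∧ (⊢-trans ∧⊢ˡ p) (⊢-trans ∧⊢ʳ q) , ⊢-∧ (⊢-trans ∧⊢ˡ p′) (⊢-trans ∧⊢ʳ q′)

  ∨-cong-⊣⊢ : ∀ {x x′ y y′} → x ⊣⊢ x′ → y ⊣⊢ y′ → x ∨ y ⊣⊢ x′ ∨ y′
  ∨-cong-⊣⊢ (p , p′) (q , q′) =
      ∨-⊢ (⊢-trans p ⊢∨ˡ) (⊢-trans q ⊢∨ʳ) , ∨-⊢ (⊢-trans p′ ⊢∨ˡ) (⊢-trans q′ ⊢∨ʳ)

  ⊃-cong-⊣⊢ : ∀ {x x′ y y′} → x ⊣⊢ x′ → y ⊣⊢ y′ → x ⊃ y ⊣⊢ x′ ⊃ y′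
  ⊃-cong-⊣⊢ (p , p′) (q , q′) =
      ⊢-curry (⊢-trans (⊢-∧ ∧⊢ˡ (⊢-trans ∧⊢ʳ p′)) (⊢-trans ⊃-⊢ q))
    , ⊢-curry (⊢-trans (⊢-∧ ∧⊢ˡ (⊢-trans ∧⊢ʳ p)) (⊢-trans ⊃-⊢ q′))

  ¬⊃⊣⊢∧¬ : ∀ x y → ¬ (x ⊃ y) ⊣⊢ x ∧ ¬ y
  ¬⊃⊣⊢∧¬ x y = Dense-cong (sym (IB6 x y _)) ⊢-refl , Dense-cong (IB6 x y _) ⊢-refl

  -- Coordinates in an implicative bilattice, up to `⊣⊢`.

  Coordinates : Carrier → Carrier × Carrier → Set (c ⊔ ℓ)
  Coordinates x (p , q) = x ⊣⊢ p × ¬ x ⊣⊢ q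

  -- Entailment from x to y gives x ≤ₜ x ⊗ y; entailment between the negations gives the reverse
  -- inequality, because `¬_` commutes with `⊗`. Hence x ≈ x ⊗ y, and likewise for y.
  coordinates-unique : ∀ {x y p q} → Coordinates x (p , q) → Coordinates y (p , q) → x ≈ y
  coordinates-unique (x⊣⊢p , ¬x⊣⊢q) (y⊣⊢p , ¬y⊣⊢q) =
    trans (≈⊗ (⊣⊢-trans x⊣⊢p (swap y⊣⊢p)) (⊣⊢-trans ¬x⊣⊢q (swap ¬y⊣⊢q)))
      (trans (K.∧-comm _ _)
        (sym (≈⊗ (⊣⊢-trans y⊣⊢p (swap x⊣⊢p)) (⊣⊢-trans ¬y⊣⊢q (swap ¬x⊣⊢q)))))
    where
    ≈⊗ : ∀ {x y} → x ⊣⊢ y → ¬ x ⊣⊢ ¬ y → x ≈ x ⊗ y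
    ≈⊗ {x} {y} (x⊢y , _) (¬x⊢¬y , _) = T≤.antisym (⊢⇒≤ₜ⊗ x⊢y)
      (T≤.trans (T≤.reflexive (sym (¬-involutive _)))
        (T≤.trans
          (¬-antitoneₜ (T≤.trans (⊢⇒≤ₜ⊗ ¬x⊢¬y) (T≤.reflexive (sym (¬-distrib-⊗ x y)))))
          (T≤.reflexive (¬-involutive x))))

  coordinates-cong : ∀ {x p p′ q q′} → p ⊣⊢ p′ → q ⊣⊢ q′ →
    Coordinates x (p , q) → Coordinates x (p′ , q′)
  coordinates-cong p q (x⊣⊢p , ¬x⊣⊢q) = ⊣⊢-trans x⊣⊢p p , ⊣⊢-trans ¬x⊣⊢q q

  module _ {x y p q p′ q′ : Carrier}
    (x-coordinates : Coordinates x (p , q)) (y-coordinates : Coordinates y (p′ , q′)) where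

    private
      x⊣⊢p = proj₁ x-coordinates
      ¬x⊣⊢q = proj₂ x-coordinates
      y⊣⊢p′ = proj₁ y-coordinates
      ¬y⊣⊢q′ = proj₂ y-coordinates

    coordinates-∧ : Coordinates (x ∧ y) (p ∧ p′ , q ∨ q′)
    coordinates-∧ =
        ∧-cong-⊣⊢ x⊣⊢p y⊣⊢p′
      , ⊣⊢-trans (⊣⊢-reflexive (¬-distrib-∧ x y)) (∨-cong-⊣⊢ ¬x⊣⊢q ¬y⊣⊢q′)

    coordinates-∨ : Coordinates (x ∨ y) (p ∨ p′ , q ∧ q′)
    coordinates-∨ =
        ∨-cong-⊣⊢ x⊣⊢p y⊣⊢p′
      , ⊣⊢-trans (⊣⊢-reflexive (¬-distrib-∨ x y)) (∧-cong-⊣⊢ ¬x⊣⊢q ¬y⊣⊢q′)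

    coordinates-⊗ : Coordinates (x ⊗ y) (p ∧ p′ , q ∧ q′)
    coordinates-⊗ =
        ⊣⊢-trans (⊗⊣⊢∧ x y) (∧-cong-⊣⊢ x⊣⊢p y⊣⊢p′)
      , ⊣⊢-trans (⊣⊢-reflexive (¬-distrib-⊗ x y))
          (⊣⊢-trans (⊗⊣⊢∧ (¬ x) (¬ y)) (∧-cong-⊣⊢ ¬x⊣⊢q ¬y⊣⊢q′))

    coordinates-⊕ : Coordinates (x ⊕ y) (p ∨ p′ , q ∨ q′)
    coordinates-⊕ =
        ⊣⊢-trans (⊕⊣⊢∨ x y) (∨-cong-⊣⊢ x⊣⊢p y⊣⊢p′)
      , ⊣⊢-trans (⊣⊢-reflexive (¬-distrib-⊕ x y))
          (⊣⊢-trans (⊕⊣⊢∨ (¬ x) (¬ y)) (∨-cong-⊣⊢ ¬x⊣⊢q ¬y⊣⊢q′))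

    coordinates-⊃ : Coordinates (x ⊃ y) (p ⊃ p′ , p ∧ q′)
    coordinates-⊃ =
        ⊃-cong-⊣⊢ x⊣⊢p y⊣⊢p′
      , ⊣⊢-trans (¬⊃⊣⊢∧¬ x y) (∧-cong-⊣⊢ x⊣⊢p ¬y⊣⊢q′)

  coordinates-¬ : ∀ {x p q} → Coordinates x (p , q) → Coordinates (¬ x) (q , p)
  coordinates-¬ (x⊣⊢p , ¬x⊣⊢q) = ¬x⊣⊢q , ⊣⊢-trans (⊣⊢-reflexive (¬-involutive _)) x⊣⊢p

  -- A lattice homomorphism transports the complement equations of `∖`, and these already determine
  -- `⊃`. For the converse entailment the dense x ∨ z is added as a premise and split into cases.
  complement⇒⊣⊢⊃ : ∀ {x y z} → x ∧ z ⊣⊢ x ∧ y → Dense (x ∨ z) → z ⊣⊢ x ⊃ y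
  complement⇒⊣⊢⊃ {x} {y} {z} (x∧z⊢x∧y , x∧y⊢x∧z) x∨z =
      ⊢-curry (⊢-trans (⊢-∧ ∧⊢ʳ ∧⊢ˡ) (⊢-trans x∧z⊢x∧y ∧⊢ʳ))
    , ⊢-trans (⊢-∧ (Dense-⊢ x∨z) ⊢-refl) (⊢-uncurry (∨-⊢
        (⊢-curry (⊢-trans (⊢-∧ ∧⊢ˡ (⊢-trans (⊢-∧ ∧⊢ʳ ∧⊢ˡ) ⊃-⊢)) (⊢-trans x∧y⊢x∧z ∧⊢ʳ)))
        (⊢-curry ∧⊢ˡ)))

-- Extending a homomorphism from `𝐀` to the square.

module Extension
  (𝐀 : ResiduatedDeMorganLattice c ℓ) (rc : RelativelyComplemented (𝐀 ⁻))
  (𝐁₁ : ImplicativeBilattice c₁ ℓ₁)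
  (f : ResiduatedDeMorganLattice.Carrier 𝐀 → ImplicativeBilattice.Carrier 𝐁₁)
  (f-isHomomorphism : IsResiduatedHomomorphism 𝐀 𝐁₁ f)
  where

  private
    module A = ResiduatedDeMorganLattice 𝐀
    module AL = DistributiveLattice A.distributiveLattice
    module A≤ = Order.Lattice
      (DistributiveLatticeProperties.∨-∧-orderTheoreticLattice A.distributiveLattice)
    module A⁻ = DistributiveLattice (𝐀 ⁻)
    module R = Residuated 𝐀
    module B = ImplicativeBilattice (square⁻ 𝐀 rc)
    module S = Square (𝐀 ⁻) rc (A.⊤ , A≤.refl) proj₂
  open ImplicativeBilattice 𝐁₁
  open Lattice latticeₜ using (refl; sym; trans)
  open Lattice latticeₖ using () renaming (∧-cong to ⊗-cong)
  open Implicative 𝐁₁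
  open IsResiduatedHomomorphism f-isHomomorphism
  open IsLatticeHomomorphism isLatticeHomomorphism renaming (⟦⟧-cong to f-cong)

  e : A⁻.Carrier → Carrier
  e = f ∘ proj₁

  -- As ⊤ ≈ ⊤ ⊃ ⊤ in `𝐀`, its image has the form y ⊃ y, which is dense by (IB1).
  dense-⊤≤ : ∀ {x} → A.⊤ A.≤ x → Dense (f x)
  dense-⊤≤ {x} ⊤≤x = Dense-upₜ (trans (f-cong ⊤≤x) (∧-homo A.⊤ x))
    (Dense-cong (trans (sym (⊃-homo A.⊤ A.⊤)) (f-cong (A.RD1 A.⊤))) ⊢-refl)

  f-∧⊤ : ∀ x → f (x A.∧ A.⊤) ⊣⊢ f x
  f-∧⊤ x = ⊣⊢-trans (⊣⊢-reflexive (∧-homo x A.⊤))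
    (∧-identityʳ-⊣⊢ (dense-⊤≤ A≤.refl))

  extension : B.Carrier → Carrier
  extension (a , b) = e a ⊗ ¬ e b

  dense-¬ : ∀ a → Dense (¬ e a)
  dense-¬ (a , a≤⊤) = Dense-cong (¬-homo a) (dense-⊤≤ (R.≤⊤⇒⊤≤¬ a≤⊤))

  extension-coordinates : ∀ x → Coordinates (extension x) (e (proj₁ x) , e (proj₂ x))
  extension-coordinates (a , b) =
      ⊣⊢-trans (⊗⊣⊢∧ _ _) (∧-identityʳ-⊣⊢ (dense-¬ b))
    , ⊣⊢-trans (⊣⊢-reflexive (trans (¬-distrib-⊗ _ _) (⊗-cong refl (¬-involutive _))))
        (⊣⊢-trans (⊗⊣⊢∧ _ _) (∧-identityˡ-⊣⊢ (dense-¬ a)))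

  -- Each preservation law below reduces to computing the coordinates of its right-hand side.
  extension-unique : ∀ x {y} → Coordinates y (e (proj₁ x) , e (proj₂ x)) → extension x ≈ y
  extension-unique x = coordinates-unique (extension-coordinates x)

  e-∖ : ∀ a b → e (a S.∖ b) ⊣⊢ e a ⊃ e b
  e-∖ a b = complement⇒⊣⊢⊃
    (⊣⊢-reflexive (trans (sym (∧-homo _ _))
      (trans (f-cong (proj₁ (proj₂ (S.complement a b)))) (∧-homo _ _))))
    (Dense-cong (trans (f-cong (AL.sym (proj₂ (proj₂ (S.complement a b))))) (∨-homo _ _))
      (dense-⊤≤ A≤.refl))

  extension-isBilatticeHomomorphism :
    IsBilatticeHomomorphism (square⁻ 𝐀 rc) 𝐁₁ extension
  extension-isBilatticeHomomorphism = record
    { isLatticeHomomorphismₜ = record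
      { isRelHomomorphism = record { cong = λ {x} {y} → extension-cong {x} {y} }
      ; ∧-homo = λ x y → extension-unique (x B.∧ y)
          (coordinates-cong (≈⇒⊣⊢ (∧-homo _ _)) (≈⇒⊣⊢ (∨-homo _ _))
            (coordinates-∧ (extension-coordinates x) (extension-coordinates y)))
      ; ∨-homo = λ x y → extension-unique (x B.∨ y)
          (coordinates-cong (≈⇒⊣⊢ (∨-homo _ _)) (≈⇒⊣⊢ (∧-homo _ _))
            (coordinates-∨ (extension-coordinates x) (extension-coordinates y)))
      }
    ; isLatticeHomomorphismₖ = record
      { isRelHomomorphism = record { cong = λ {x} {y} → extension-cong {x} {y} }
      ; ∧-homo = λ x y → extension-unique (x B.⊗ y)
          (coordinates-cong (≈⇒⊣⊢ (∧-homo _ _)) (≈⇒⊣⊢ (∧-homo _ _))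
            (coordinates-⊗ (extension-coordinates x) (extension-coordinates y)))
      ; ∨-homo = λ x y → extension-unique (x B.⊕ y)
          (coordinates-cong (≈⇒⊣⊢ (∨-homo _ _)) (≈⇒⊣⊢ (∨-homo _ _))
            (coordinates-⊕ (extension-coordinates x) (extension-coordinates y)))
      }
    ; ⊃-homo = λ x y → extension-unique (x B.⊃ y)
        (coordinates-cong (swap (e-∖ (proj₁ x) (proj₁ y))) (≈⇒⊣⊢ (∧-homo _ _))
          (coordinates-⊃ (extension-coordinates x) (extension-coordinates y)))
    ; ¬-homo = λ x → extension-unique (B.¬ x) (coordinates-¬ (extension-coordinates x))
    }
    where
    extension-cong : ∀ {x y} → x B.≈ y → extension x ≈ extension y
    extension-cong (p , q) = ⊗-cong (f-cong p) (¬-cong (f-cong q))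
    ≈⇒⊣⊢ : ∀ {x y} → x ≈ y → y ⊣⊢ x
    ≈⇒⊣⊢ p = ⊣⊢-reflexive (sym p)

  extension-extends : ∀ x → extension (canonical 𝐀 x) ≈ f x
  extension-extends x = extension-unique (canonical 𝐀 x)
    (swap (f-∧⊤ x) , ⊣⊢-trans (⊣⊢-reflexive (sym (¬-homo x))) (swap (f-∧⊤ (A.¬ x))))

  extension-determined : ∀ g → IsBilatticeHomomorphism (square⁻ 𝐀 rc) 𝐁₁ g →
    (∀ x → g (canonical 𝐀 x) ≈ f x) → ∀ y → g y ≈ extension y
  extension-determined g g-isHomomorphism g∘h≈f (a , b) = begin
    g (a , b)                                       ≈⟨ g-cong (R.canonical-generates rc a b) ⟩
    g (canonical 𝐀 (proj₁ a) B.⊗ canonical 𝐀 (A.¬ (proj₁ b)))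
                                                    ≈⟨ g-⊗ _ _ ⟩
    g (canonical 𝐀 (proj₁ a)) ⊗ g (canonical 𝐀 (A.¬ (proj₁ b)))
                                                    ≈⟨ ⊗-cong (g∘h≈f _) (g∘h≈f _) ⟩
    e a ⊗ f (A.¬ (proj₁ b))                         ≈⟨ ⊗-cong refl (¬-homo _) ⟩
    extension (a , b)                               ∎
    where
    open ≈-Reasoning (Lattice.setoid latticeₜ)
    open IsLatticeHomomorphism
      (IsBilatticeHomomorphism.isLatticeHomomorphismₖ g-isHomomorphism)
      using () renaming (⟦⟧-cong to g-cong; ∧-homo to g-⊗)

  -- The negations of e a and e b are both dense, so their second coordinates agree automatically
  -- and the first decides equality.
  e-reflects : Injective A._≈_ _≈_ f → ∀ a b → e a ⊣⊢ e b → a A⁻.≈ b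
  e-reflects f-injective a b ea⊣⊢eb = f-injective (coordinates-unique
    (ea⊣⊢eb , Dense-⊢ (dense-¬ b) , Dense-⊢ (dense-¬ a)) (⊣⊢-refl , ⊣⊢-refl))

  extension-injective : Injective A._≈_ _≈_ f → Injective B._≈_ _≈_ extension
  extension-injective f-injective {x} {y} p =
    let x₁ , x₂ = extension-coordinates x
        y₁ , y₂ = extension-coordinates y
    in e-reflects f-injective (proj₁ x) (proj₁ y)
         (⊣⊢-trans (swap x₁) (⊣⊢-trans (⊣⊢-reflexive p) y₁))
     , e-reflects f-injective (proj₂ x) (proj₂ y)
         (⊣⊢-trans (swap x₂) (⊣⊢-trans (⊣⊢-reflexive (¬-cong p)) y₂))

theorem5p4p5 :
  ∀ {c ℓ c₁ ℓ₁} (𝐀 : ResiduatedDeMorganLattice c ℓ) →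
  let module A = ResiduatedDeMorganLattice 𝐀 in
  DuallyIsomorphic (𝐀 ⁻) (𝐀 ⁺)
  × Σ[ rc⁻ ∈ RelativelyComplemented (𝐀 ⁻) ]
    Σ[ rc⁺ ∈ RelativelyComplemented (𝐀 ⁺) ]
    let 𝐁 = square⁻ 𝐀 rc⁻
        module B = ImplicativeBilattice 𝐁
        h = canonical 𝐀
    in
    (IsResiduatedEmbedding 𝐀 𝐁 h
     × ∃ (IsResiduatedEmbedding 𝐀 (square⁺ 𝐀 rc⁺)))
    × ((𝐁₁ : ImplicativeBilattice c₁ ℓ₁) →
       let module B₁ = ImplicativeBilattice 𝐁₁ in
       (f : A.Carrier → B₁.Carrier) → IsResiduatedHomomorphism 𝐀 𝐁₁ f →
       Σ[ f′ ∈ (B.Carrier → B₁.Carrier) ]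
         (IsBilatticeHomomorphism 𝐁 𝐁₁ f′ × (∀ x → f′ (h x) B₁.≈ f x))
         × (∀ (g : B.Carrier → B₁.Carrier) → IsBilatticeHomomorphism 𝐁 𝐁₁ g →
            (∀ x → g (h x) B₁.≈ f x) → ∀ y → g y B₁.≈ f′ y)
         × (Injective A._≈_ B₁._≈_ f → Injective B._≈_ B₁._≈_ f′))
theorem5p4p5 𝐀 =
    (¬⁺ , ¬⁺-isLatticeIsomorphism)
  , relativelyComplemented⁻
  , relativelyComplemented⁺
  , (canonical-isResiduatedEmbedding , embedding⁺)
  , λ 𝐁₁ f f-isHomomorphism →
      let module E = Extension 𝐀 relativelyComplemented⁻ 𝐁₁ f f-isHomomorphism
      in E.extension
       , (E.extension-isBilatticeHomomorphism , E.extension-extends)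
       , E.extension-determined
       , E.extension-injective
  where
  open Residuated 𝐀
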